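{- Let $\mathcal L$ be a planar graph embedded in the plane such that: (i) the bounded faces of $\mathcal L$ are $2$-colorable with colors gray and white; (ii) all gray faces of $\mathcal L$ are triangles; (iii) every edge of $\mathcal L$ belongs to precisely one gray triangle; (iv) exactly one angle (corner) of each gray triangle is marked; and (v) each vertex of $\mathcal L$ is incident to at most two unmarked angles of gray triangles. Then $\operatorname{col}_{ve}(\mathcal L) \le 4$.
   Context: The vertex-edge marking game on a graph $G=(V,E)$ (finite or infinite) is played by Alice, who marks vertices, and Bob, who marks edges. Initially nothing is marked. The game proceeds in rounds $r=1,2,\dots$; in each round Alice first marks one unmarked vertex, then Bob marks one unmarked edge. For a finite graph the game ends when either player has no move; for an infinite graph it continues forever. After round $r$, the vertex score of $v$ is $0$ if $v$ is marked, and otherwise the number of marked edges incident to $v$. The $r$-round score is the supremum over $v\in V$ of the vertex scores after round $r$, and the final score of the game is the supremum of the $r$-round scores over all rounds. Bob has a winning strategy for score $s$ if, whatever Alice plays, Bob can force the final score to be at least $s$. The vertex-edge coloring number is $\operatorname{col}_{ve}(G)=\sup\{s : \text{Bob has a winning strategy for score } s\}+1$. An angle of a gray triangle is one of its three corners, i.e. a pair (triangle, vertex of the triangle); a vertex is incident to an angle if it is the vertex of that corner. -}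

module Defs where

open import Axiom.ExcludedMiddle using (ExcludedMiddle)
open import Data.Bool using (if_then_else_)
open import Data.List using (List; []; _∷_; map; filter; length)
open import Data.List.Membership.Propositional using (_∈_; _∉_)
open import Data.Nat as ℕ using (ℕ; zero; suc)
import Data.Nat.Properties as ℕₚ
open import Data.Product using (∃; _×_; _,_; proj₁; proj₂)
open import Data.Rational as ℚ using (ℚ; 0ℚ; 1ℚ; ∣_∣)
import Data.Rational.Properties as ℚₚ
open import Data.Sum using (_⊎_; inj₁; inj₂)
open import Function using (_⇔_)
open import Level using (0ℓ)
open import Relation.Binary.Construct.Closure.Equivalence using (EqClosure)
open import Relation.Binary.Construct.Add.Supremum.NonStrict ℕ._≤_ using (_≤⁺_; [_]; _≤⊤⁺)
open import Relation.Binary.PropositionalEquality using (_≡_; _≢_; sym; subst)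
open import Relation.Nullary using (Dec; yes; no; does; ¬_; contradiction)
open import Relation.Nullary.Construct.Add.Supremum using (_⁺; ⊤⁺; [_])

------------------------------------------------------------------------
-- Extended naturals and suprema

ℕ∞ : Set
ℕ∞ = ℕ ⁺

suc∞ : ℕ∞ → ℕ∞
suc∞ [ n ] = [ suc n ]
suc∞ ⊤⁺    = ⊤⁺

UpperBound : (ℕ∞ → Set) → ℕ∞ → Set
UpperBound S b = ∀ x → S x → x ≤⁺ b

module Supremum (em : ExcludedMiddle 0ℓ) where

  -- The least upper bound of S, given that b is one.
  descend : (ℕ∞ → Set) → ℕ → ℕ
  descend S zero    = zero
  descend S (suc b) with em {UpperBound S [ b ]}
  ... | yes _ = descend S b
  ... | no  _ = suc b

  sup : (ℕ∞ → Set) → ℕ∞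
  sup S with em {∃ λ b → UpperBound S [ b ]}
  ... | yes (b , _) = [ descend S b ]
  ... | no  _       = ⊤⁺

  descend-upper : ∀ S b → UpperBound S [ b ] → UpperBound S [ descend S b ]
  descend-upper S zero    ub = ub
  descend-upper S (suc b) ub with em {UpperBound S [ b ]}
  ... | yes ub′ = descend-upper S b ub′
  ... | no  _   = ub

  descend-least : ∀ S b c → UpperBound S [ c ] → descend S b ℕ.≤ c
  descend-least S zero    c ub = ℕ.z≤n
  descend-least S (suc b) c ub with em {UpperBound S [ b ]}
  ... | yes _  = descend-least S b c ub
  ... | no ¬ub with ℕₚ.≤-<-connex c b
  ...   | inj₂ b<c = b<c
  ...   | inj₁ c≤b = contradiction (λ x Sx → weaken (ub x Sx)) ¬ub
    where
    weaken : ∀ {x} → x ≤⁺ [ c ] → x ≤⁺ [ b ]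
    weaken [ x≤c ] = [ ℕₚ.≤-trans x≤c c≤b ]

  sup-upper : ∀ S → UpperBound S (sup S)
  sup-upper S with em {∃ λ b → UpperBound S [ b ]}
  ... | yes (b , ub) = descend-upper S b ub
  ... | no  _        = λ x _ → x ≤⊤⁺

  sup-least : ∀ S c → UpperBound S c → sup S ≤⁺ c
  sup-least S c ub with em {∃ λ b → UpperBound S [ b ]}
  sup-least S [ c ] ub | yes (b , _) = [ descend-least S b c ub ]
  sup-least S ⊤⁺    ub | yes (b , _) = [ descend S b ] ≤⊤⁺
  sup-least S [ c ] ub | no ¬bounded = contradiction (c , ub) ¬bounded
  sup-least S ⊤⁺    ub | no _        = ⊤⁺ ≤⊤⁺

------------------------------------------------------------------------
-- Graphs (simple, finite or infinite)

record Graph : Set₁ where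
  field
    V E       : Set
    -- The order of the two ends of an edge carries no meaning.
    end₀ end₁ : E → V

  Joins : E → V → V → Set
  Joins e u v = (end₀ e ≡ u × end₁ e ≡ v) ⊎ (end₀ e ≡ v × end₁ e ≡ u)

  Incident : V → E → Set
  Incident v e = end₀ e ≡ v ⊎ end₁ e ≡ v

  field
    loopless   : ∀ e → end₀ e ≢ end₁ e
    noParallel : ∀ {e e′ u v} → Joins e u v → Joins e′ u v → e ≡ e′

------------------------------------------------------------------------
-- The vertex-edge marking game

module Game (em : ExcludedMiddle 0ℓ) (G : Graph) where
  open Graph G
  open Supremum em

  -- The completed rounds, latest first: Alice's vertex and Bob's edge.
  History : Set
  History = List (V × E)

  markedVertices : History → List V
  markedVertices = map proj₁

  markedEdges : History → List E
  markedEdges = map proj₂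

  -- A strategy answers every history with a legal move, or with a proof
  -- that the player has none.
  AliceStrategy : Set
  AliceStrategy = (h : History) → Dec (∃ λ v → v ∉ markedVertices h)

  -- Bob also sees the vertex that Alice has just marked.
  BobStrategy : Set
  BobStrategy = (h : History) → V → Dec (∃ λ e → e ∉ markedEdges h)

  -- If a player has no move the game is over and the history stays
  -- constant.  A vertex marked by Alice in a round that Bob cannot complete
  -- is not recorded: no score is taken after that round.
  playRound : AliceStrategy → BobStrategy → History → History
  playRound α β h with α h
  ... | no _        = h
  ... | yes (v , _) with β h v
  ...   | no _        = h
  ...   | yes (e , _) = (v , e) ∷ h

  after : AliceStrategy → BobStrategy → ℕ → History
  after α β zero    = []
  after α β (suc r) = playRound α β (after α β r)

  vertexScore : History → V → ℕ
  vertexScore h v =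
    if does (em {v ∈ markedVertices h})
    then 0
    else length (filter (λ e → em {Incident v e}) (markedEdges h))

  score : History → ℕ∞
  score h = sup (λ x → ∃ λ v → x ≡ [ vertexScore h v ])

  finalScore : AliceStrategy → BobStrategy → ℕ∞
  finalScore α β = sup (λ x → ∃ λ r → x ≡ score (after α β r))

  BobWins : ℕ → Set
  BobWins s = ∃ λ (β : BobStrategy) → ∀ (α : AliceStrategy) → [ s ] ≤⁺ finalScore α β

  col-ve : ℕ∞
  col-ve = suc∞ (sup (λ x → ∃ λ s → x ≡ [ s ] × BobWins s))

open Game public using (col-ve)

------------------------------------------------------------------------
-- Real numbers (Cauchy sequences of rationals, up to _≈_) and the plane

record ℝ : Set where
  field
    seq    : ℕ → ℚ
    cauchy : ∀ ε → 0ℚ ℚ.< ε →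
             ∃ λ N → ∀ m n → N ℕ.≤ m → N ℕ.≤ n → ∣ seq m ℚ.- seq n ∣ ℚ.< ε
open ℝ

fromℚ : ℚ → ℝ
fromℚ q .seq _ = q
fromℚ q .cauchy ε 0<ε =
  0 , λ _ _ _ _ → subst (λ d → ∣ d ∣ ℚ.< ε) (sym (ℚₚ.+-inverseʳ q)) 0<ε

0ℝ 1ℝ : ℝ
0ℝ = fromℚ 0ℚ
1ℝ = fromℚ 1ℚ

infix 4 _<_ _≤_ _≈_ _≋_

-- ∣ x - y ∣ < ε; the gap between δ and ε makes the limit inequality strict.
Within : ℚ → ℝ → ℝ → Set
Within ε x y = ∃ λ δ → δ ℚ.< ε ×
  (∃ λ N → ∀ n → N ℕ.≤ n → ∣ seq x n ℚ.- seq y n ∣ ℚ.≤ δ)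

_≈_ : ℝ → ℝ → Set
x ≈ y = ∀ ε → 0ℚ ℚ.< ε → Within ε x y

_<_ : ℝ → ℝ → Set
x < y = ∃ λ δ → 0ℚ ℚ.< δ × (∃ λ N → ∀ n → N ℕ.≤ n → seq x n ℚ.+ δ ℚ.≤ seq y n)

_≤_ : ℝ → ℝ → Set
x ≤ y = ¬ (y < x)

Point : Set
Point = ℝ × ℝ

_≋_ : Point → Point → Set
(x , y) ≋ (x′ , y′) = x ≈ x′ × y ≈ y′

-- Open balls of the maximum metric; they generate the Euclidean topology and
-- have the same bounded sets.
Near : ℚ → Point → Point → Set
Near ε (x , y) (x′ , y′) = Within ε x x′ × Within ε y y′

origin : Point
origin = 0ℝ , 0ℝ

UnitInterval : ℝ → Set
UnitInterval t = 0ℝ ≤ t × t ≤ 1ℝ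

-- A path is given on [0,1]; the values of `at` elsewhere are irrelevant.
record Path : Set where
  field
    at         : ℝ → Point
    continuous : ∀ t → UnitInterval t → ∀ ε → 0ℚ ℚ.< ε →
                 ∃ λ δ → 0ℚ ℚ.< δ ×
                 (∀ u → UnitInterval u → Within δ t u → Near ε (at t) (at u))

record Arc : Set where
  field
    path      : Path
  open Path path public
  field
    injective : ∀ {t u} → UnitInterval t → UnitInterval u → at t ≋ at u → t ≈ u

------------------------------------------------------------------------
-- Graphs embedded in the plane

record PlaneGraph : Set₁ where
  field
    graph : Graph
  open Graph graph public
  field
    position : V → Point
    arc      : E → Arc

  arcAt : E → ℝ → Point
  arcAt e = Arc.at (arc e)

  field
    position-injective : ∀ {u v} → position u ≋ position v → u ≡ v
    arc-start          : ∀ e → arcAt e 0ℝ ≋ position (end₀ e)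
    arc-end            : ∀ e → arcAt e 1ℝ ≋ position (end₁ e)
    -- The interior of an edge contains no vertex and no point of another edge.
    interior-vertex    : ∀ {e t v} → 0ℝ < t → t < 1ℝ → ¬ (arcAt e t ≋ position v)
    interior-edge      : ∀ {e e′ t u} → 0ℝ < t → t < 1ℝ → UnitInterval u →
                         arcAt e t ≋ arcAt e′ u → e ≡ e′

data Colour : Set where
  gray white : Colour

module _ (L : PlaneGraph) where
  open PlaneGraph L

  OnEdge : Point → E → Set
  OnEdge p e = ∃ λ t → UnitInterval t × p ≋ arcAt e t

  OnDrawing : Point → Set
  OnDrawing p = (∃ λ v → p ≋ position v) ⊎ (∃ λ e → OnEdge p e)

  JoinedOff : Point → Point → Set
  JoinedOff p q = ∃ λ (γ : Path) → Path.at γ 0ℝ ≋ p × Path.at γ 1ℝ ≋ q ×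
    (∀ t → UnitInterval t → ¬ OnDrawing (Path.at γ t))

  -- A face is a path component of the complement of the drawing.  It is
  -- represented by any of its points; SameFace is equality of faces.
  record Face : Set where
    field
      point : Point
      off   : ¬ OnDrawing point
  open Face

  -- Paths can be reversed and concatenated, so on the complement of the
  -- drawing JoinedOff already is an equivalence relation; the closure only
  -- makes this immediate.
  InFace : Point → Face → Set
  InFace q f = ¬ OnDrawing q × EqClosure JoinedOff q (point f)

  SameFace : Face → Face → Set
  SameFace f g = EqClosure JoinedOff (point f) (point g)

  Bounded : Face → Set
  Bounded f = ∃ λ M → ∀ q → InFace q f → Near M q origin

  Frontier : Face → Point → Set
  Frontier f p = ∀ ε → 0ℚ ℚ.< ε →
    (∃ λ q → Near ε p q × InFace q f) × (∃ λ q → Near ε p q × ¬ InFace q f)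

  EdgeOnFrontier : E → Face → Set
  EdgeOnFrontier e f = ∀ p → OnEdge p e → Frontier f p

  -- A 3-cycle; the corners are distinct because there are no loops.
  record Triangle : Set where
    field
      a b c    : V
      ab bc ca : E
      ab-joins : Joins ab a b
      bc-joins : Joins bc b c
      ca-joins : Joins ca c a

    IsCorner : V → Set
    IsCorner v = v ≡ a ⊎ v ≡ b ⊎ v ≡ c

    IsSide : E → Set
    IsSide e = e ≡ ab ⊎ e ≡ bc ⊎ e ≡ ca

  BoundedBy : Face → Triangle → Set
  BoundedBy f T = ∀ p → Frontier f p ⇔ (∃ λ e → Triangle.IsSide T e × OnEdge p e)

  IsTriangle : Face → Set
  IsTriangle f = ∃ λ T → BoundedBy f T

  CornerOf : V → Face → Set
  CornerOf v f = ∃ λ T → BoundedBy f T × Triangle.IsCorner T v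

  SideOf : E → Face → Set
  SideOf e f = ∃ λ T → BoundedBy f T × Triangle.IsSide T e

  -- A proper colouring of the bounded faces; the values on unbounded faces
  -- are irrelevant.
  record TwoColouring : Set where
    field
      colour   : Face → Colour
      respects : ∀ {f g} → Bounded f → SameFace f g → colour f ≡ colour g
      proper   : ∀ {f g} e → Bounded f → Bounded g → ¬ SameFace f g →
                 EdgeOnFrontier e f → EdgeOnFrontier e g → colour f ≢ colour g

  -- A set of angles; only pairs (f , v) with v a corner of the gray triangle f
  -- are relevant.
  record AngleMarking : Set₁ where
    field
      Marked   : Face → V → Set
      respects : ∀ {f g v} → SameFace f g → Marked f v → Marked g v

  module _ (κ : TwoColouring) where
    open TwoColouring κ

    Gray : Face → Set
    Gray f = Bounded f × colour f ≡ gray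

    GrayFacesAreTriangles : Set
    GrayFacesAreTriangles = ∀ f → Gray f → IsTriangle f

    EachEdgeInExactlyOneGrayTriangle : Set
    EachEdgeInExactlyOneGrayTriangle = ∀ e → ∃ λ f →
      Gray f × SideOf e f × (∀ g → Gray g → SideOf e g → SameFace f g)

    module _ (M : AngleMarking) where
      open AngleMarking M using (Marked)

      ExactlyOneMarkedAnglePerGrayTriangle : Set
      ExactlyOneMarkedAnglePerGrayTriangle = ∀ f → Gray f → ∃ λ v →
        CornerOf v f × Marked f v × (∀ w → CornerOf w f → Marked f w → v ≡ w)

      UnmarkedAngle : Face → V → Set
      UnmarkedAngle f v = Gray f × CornerOf v f × ¬ Marked f v

      AtMostTwoUnmarkedAnglesPerVertex : Set
      AtMostTwoUnmarkedAnglesPerVertex = ∀ v f g h →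
        UnmarkedAngle f v → UnmarkedAngle g v → UnmarkedAngle h v →
        SameFace f g ⊎ SameFace g h ⊎ SameFace f h

{-# OPTIONS --safe #-}

-- Group the edges of L by the gray triangle to which they belong.  Alice answers
-- an edge of a triangle T by marking a corner of T: the marked angle first,
-- and the remaining two corners in an order such that, after her move, an
-- unmarked vertex has at most one marked edge in T, and none if T is marked
-- there.  A vertex v has at most two unmarked angles, so after Alice's move an
-- unmarked v has at most two marked edges, and Bob adds at most one more.
module Submission where

open import Defs
open import Axiom.ExcludedMiddle using (ExcludedMiddle)
open import Data.List using (List; []; _∷_; filter; length)
open import Data.List.Membership.Propositional using (_∈_; _∉_)
open import Data.List.Membership.Propositional.Properties using (∈-filter⁻)
open import Data.List.Relation.Unary.All using (_∷_)
open import Data.List.Relation.Unary.All.Properties using (¬Any⇒All¬)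
open import Data.List.Relation.Unary.AllPairs using ([]; _∷_)
open import Data.List.Relation.Unary.Any using (here; there)
open import Data.List.Relation.Unary.Unique.Propositional using (Unique)
open import Data.List.Relation.Unary.Unique.Propositional.Properties using (filter⁺)
open import Data.Nat as ℕ using (ℕ; zero; suc; z≤n; s≤s)
import Data.Nat.Properties as ℕₚ
open import Data.Product using (∃; _×_; _,_; proj₁; proj₂)
import Data.Product as Product
open import Data.Rational as ℚ using (0ℚ; 1ℚ; ½)
import Data.Rational.Properties as ℚₚ
open import Data.Sum using (_⊎_; inj₁; inj₂)
import Data.Sum as Sum
open import Function using (_∘_; mk⇔; Equivalence)
open import Level using (0ℓ)
open import Relation.Binary.Construct.Add.Supremum.NonStrict ℕ._≤_ using (_≤⁺_; [_]; ≤⁺-trans)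
open import Relation.Binary.Definitions using (Reflexive; Symmetric; Transitive)
import Relation.Binary.Construct.Closure.Equivalence as EqClosure
open import Relation.Binary.PropositionalEquality using (_≡_; _≢_; refl; sym; trans; cong; subst; ≢-sym)
open import Relation.Nullary using (yes; no; ¬_; contradiction)
open import Relation.Nullary.Decidable using (from-yes)
open import Relation.Nullary.Construct.Add.Supremum using ([_])

-- Edges and their ends; edge sets partitioned into triangles.

module _ (G : Graph) where
  open Graph G

  -- Puts two edges that share two distinct ends into the form to which `noParallel` applies.
  incident⇒joins : ∀ {e u v} → u ≢ v → Incident u e → Incident v e → Joins e u v
  incident⇒joins u≢v (inj₁ p) (inj₁ q) = contradiction (trans (sym p) q) u≢v
  incident⇒joins u≢v (inj₁ p) (inj₂ q) = inj₁ (p , q)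
  incident⇒joins u≢v (inj₂ p) (inj₁ q) = inj₂ (q , p)
  incident⇒joins u≢v (inj₂ p) (inj₂ q) = contradiction (trans (sym p) q) u≢v

  joins⇒≢ : ∀ {e u v} → Joins e u v → u ≢ v
  joins⇒≢ {e} (inj₁ (p , q)) u≡v = loopless e (trans p (trans u≡v (sym q)))
  joins⇒≢ {e} (inj₂ (p , q)) u≡v = loopless e (trans p (trans (sym u≡v) (sym q)))

  joins⇒ends : ∀ {e u v w} → Joins e u v → Incident w e → w ≡ u ⊎ w ≡ v
  joins⇒ends (inj₁ (p , q)) (inj₁ r) = inj₁ (trans (sym r) p)
  joins⇒ends (inj₁ (p , q)) (inj₂ r) = inj₂ (trans (sym r) q)
  joins⇒ends (inj₂ (p , q)) (inj₁ r) = inj₂ (trans (sym r) p)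
  joins⇒ends (inj₂ (p , q)) (inj₂ r) = inj₁ (trans (sym r) q)

  joins⇒incidentˡ : ∀ {e u v} → Joins e u v → Incident u e
  joins⇒incidentˡ = Sum.map proj₁ proj₂

  -- The classes of _~_ are the edge sets of the gray triangles, and apex e is
  -- the vertex of the marked angle of the triangle of e.
  record TriangleSystem : Set₁ where
    field
      _~_       : E → E → Set
      ~-refl    : Reflexive _~_
      ~-sym     : Symmetric _~_
      ~-trans   : Transitive _~_
      apex      : E → V
      apex-cong : ∀ {e f} → e ~ f → apex e ≡ apex f
      corners   : ∀ e → ∃ λ a → ∃ λ b → a ≢ b × a ≢ apex e × b ≢ apex e ×
                  (∀ {f v} → f ~ e → Incident v f → v ≡ apex e ⊎ v ≡ a ⊎ v ≡ b)
      two-bases : ∀ {v e f g} → Incident v e → Incident v f → Incident v g →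
                  apex e ≢ v → apex f ≢ v → apex g ≢ v →
                  e ~ f ⊎ f ~ g ⊎ e ~ g

-- The invariant that Alice maintains on a triangle system.

module Alice (em : ExcludedMiddle 0ℓ) (G : Graph) (𝒯 : TriangleSystem G) where
  open Graph G
  open TriangleSystem 𝒯
  open Supremum em
  open Game em G hiding (col-ve)

  -- The state of the triangle of `e` between Alice's move and Bob's reply. The stages may overlap:
  -- each bounds the marked vertices from below and the marked edges of this triangle from above.
  data Stage (vs : List V) (es : List E) (e : E) : Set where
    untouched : (∀ {f} → f ∈ es → ¬ (f ~ e)) → Stage vs es e
    apexOnly  : apex e ∈ vs →
                (∀ {f g} → f ∈ es → g ∈ es → f ~ e → g ~ e → f ≡ g) →
                Stage vs es e
    allBut    : ∀ y → y ≢ apex e →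
                (∀ {f v} → f ~ e → Incident v f → v ≢ y → v ∈ vs) →
                (∀ {f g} → f ∈ es → g ∈ es → f ~ e → g ~ e →
                 Incident y f → Incident y g → f ≡ g) →
                Stage vs es e
    complete  : (∀ {f v} → f ~ e → Incident v f → v ∈ vs) → Stage vs es e

  Safe : List V → List E → Set
  Safe vs es = ∀ e → Stage vs es e

  -- Extra marked vertices and marked edges of other triangles do no harm. Hence a spare move of
  -- Alice is safe, and Bob's edge affects one triangle only.
  Stage-mono : ∀ {vs vs′ es es′ e} →
               (∀ {v} → v ∈ vs → v ∈ vs′) →
               (∀ {f} → f ∈ es′ → f ~ e → f ∈ es) →
               Stage vs es e → Stage vs′ es′ e
  Stage-mono vs⊆ es⊇ (untouched none) = untouched λ f∈ f~ → none (es⊇ f∈ f~) f~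
  Stage-mono vs⊆ es⊇ (apexOnly c∈ uniq) =
    apexOnly (vs⊆ c∈) λ f∈ g∈ f~ g~ → uniq (es⊇ f∈ f~) (es⊇ g∈ g~) f~ g~
  Stage-mono vs⊆ es⊇ (allBut y y≢c all uniq) =
    allBut y y≢c (λ f~ vf v≢y → vs⊆ (all f~ vf v≢y))
      λ f∈ g∈ f~ g~ → uniq (es⊇ f∈ f~) (es⊇ g∈ g~) f~ g~
  Stage-mono vs⊆ es⊇ (complete all) =
    complete λ f~ vf → vs⊆ (all f~ vf)

  Stage-resp-~ : ∀ {vs es e e′} → e ~ e′ → Stage vs es e → Stage vs es e′
  Stage-resp-~ {vs} {es} {e} {e′} e~e′ = resp
    where
    c≡ : apex e ≡ apex e′
    c≡ = apex-cong e~e′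
    back : ∀ {f} → f ~ e′ → f ~ e
    back f~e′ = ~-trans f~e′ (~-sym e~e′)
    resp : Stage vs es e → Stage vs es e′
    resp (untouched none)        = untouched λ f∈ f~ → none f∈ (back f~)
    resp (apexOnly c∈ uniq)      = apexOnly (subst (_∈ vs) c≡ c∈)
      λ f∈ g∈ f~ g~ → uniq f∈ g∈ (back f~) (back g~)
    resp (allBut y y≢c all uniq) = allBut y (subst (y ≢_) c≡ y≢c) (λ f~ → all (back f~))
      λ f∈ g∈ f~ g~ → uniq f∈ g∈ (back f~) (back g~)
    resp (complete all)          = complete λ f~ → all (back f~)

  -- After `x` is marked, only `y` may be an unmarked corner. The marked edges of the triangle are
  -- among `e` and `f`, which do not both meet `y`, so at most one of them does.
  leave : ∀ {vs es e f x y} → apex e ∈ vs → y ≢ apex e →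
          (∀ {g} → g ∈ es → g ~ e → g ≡ e ⊎ g ≡ f) →
          (∀ {g v} → g ~ e → Incident v g → v ≡ apex e ⊎ v ≡ x ⊎ v ≡ y) →
          ¬ (Incident y e × Incident y f) →
          Stage (x ∷ vs) es e
  leave {vs} {es} {e} {f} {x} {y} c∈ y≢c marked cover off = allBut y y≢c
    (λ g~ vg v≢y → rest v≢y (cover g~ vg))
    (λ g∈ h∈ g~ h~ → agree (marked g∈ g~) (marked h∈ h~))
    where
    rest : ∀ {v} → v ≢ y → v ≡ apex e ⊎ v ≡ x ⊎ v ≡ y → v ∈ x ∷ vs
    rest v≢y (inj₁ refl)       = there c∈
    rest v≢y (inj₂ (inj₁ v≡x)) = here v≡x
    rest v≢y (inj₂ (inj₂ v≡y)) = contradiction v≡y v≢y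
    agree : ∀ {g h} → g ≡ e ⊎ g ≡ f → h ≡ e ⊎ h ≡ f → Incident y g → Incident y h → g ≡ h
    agree (inj₁ refl) (inj₁ refl) yg yh = refl
    agree (inj₁ refl) (inj₂ refl) yg yh = contradiction (yg , yh) off
    agree (inj₂ refl) (inj₁ refl) yg yh = contradiction (yh , yg) off
    agree (inj₂ refl) (inj₂ refl) yg yh = refl

  -- The two corners off the apex are not both common to e and f, so Alice can
  -- leave one that is not.
  leave-one : ∀ {vs es e f} → apex e ∈ vs → e ≢ f →
              (∀ {g} → g ∈ es → g ~ e → g ≡ e ⊎ g ≡ f) →
              ∃ λ x → Stage (x ∷ vs) es e
  leave-one {e = e} {f} c∈ e≢f marked with corners e
  ... | a , b , a≢b , a≢c , b≢c , cover with em {Incident a e × Incident a f}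
  ...   | no a-off      = b , leave c∈ a≢c marked (λ g~ vg → Sum.map₂ Sum.swap (cover g~ vg)) a-off
  ...   | yes (ae , af) = a , leave c∈ b≢c marked cover λ (be , bf) →
    e≢f (noParallel (incident⇒joins G a≢b ae be) (incident⇒joins G a≢b af bf))

  -- The reply to Bob's edge `e`: first the apex, then a corner chosen by `leave-one`, then the last
  -- corner. The vertex found may be marked already; `safe-answer` deals with that.
  advance : ∀ {vs es e} → Stage vs es e → ∃ λ u → Stage (u ∷ vs) (e ∷ es) e
  advance {vs} {es} {e} (untouched none) = apex e , apexOnly (here refl) uniq
    where
    is-e : ∀ {f} → f ∈ e ∷ es → f ~ e → f ≡ e
    is-e (here f≡e) _   = f≡e
    is-e (there f∈) f~e = contradiction f~e (none f∈)
    uniq : ∀ {f g} → f ∈ e ∷ es → g ∈ e ∷ es → f ~ e → g ~ e → f ≡ g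
    uniq f∈ g∈ f~ g~ = trans (is-e f∈ f~) (sym (is-e g∈ g~))
  advance {vs} {es} {e} (apexOnly c∈ uniq)
    with em {∃ λ f → f ∈ es × f ~ e × e ≢ f}
  ... | yes (f , f∈ , f~e , e≢f) = leave-one c∈ e≢f λ where
          (here g≡e)  _   → inj₁ g≡e
          (there g∈)  g~e → inj₂ (uniq g∈ f∈ g~e f~e)
  -- No marked edge of the triangle differs from `e`, so the stage persists and the apex, already
  -- marked, is a placeholder.
  ... | no only = apex e , apexOnly (here refl) λ f∈ g∈ f~ g~ →
          trans (is-e f∈ f~) (sym (is-e g∈ g~))
    where
    is-e : ∀ {f} → f ∈ e ∷ es → f ~ e → f ≡ e
    is-e (here f≡e) _ = f≡e
    is-e {f} (there f∈) f~e with em {e ≡ f}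
    ... | yes e≡f = sym e≡f
    ... | no  e≢f = contradiction (f , f∈ , f~e , e≢f) only
  advance {vs} (allBut y y≢c all uniq) = y , complete marked
    where
    marked : ∀ {f v} → f ~ _ → Incident v f → v ∈ y ∷ vs
    marked {v = v} f~ vf with em {v ≡ y}
    ... | yes v≡y = here v≡y
    ... | no  v≢y = there (all f~ vf v≢y)
  -- The stage cannot get worse; the apex is a default value.
  advance {e = e} (complete all) = apex e , complete λ f~ vf → there (all f~ vf)

  Safe-mono : ∀ {vs vs′ es} → (∀ {v} → v ∈ vs → v ∈ vs′) → Safe vs es → Safe vs′ es
  Safe-mono vs⊆ safe e = Stage-mono vs⊆ (λ f∈ _ → f∈) (safe e)

  answer : ∀ {vs es} → Safe vs es → ∀ e → ∃ λ u → Safe (u ∷ vs) (e ∷ es)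
  answer {vs} {es} safe e with advance (safe e)
  ... | u , stage = u , safe′
    where
    safe′ : Safe (u ∷ vs) (e ∷ es)
    safe′ f with em {e ~ f}
    ... | yes e~f = Stage-resp-~ e~f stage
    ... | no  e≁f = Stage-mono there old (safe f)
      where
      old : ∀ {g} → g ∈ e ∷ es → g ~ f → g ∈ es
      old (here refl) g~f = contradiction g~f e≁f
      old (there g∈)  g~f = g∈

  -- If the vertex from `answer` is already marked, the position is safe without a new vertex, and
  -- by monotonicity Alice may mark the spare `v`.
  safe-answer : ∀ {vs es v} → Safe vs es → v ∉ vs → ∀ e → ∃ λ u → u ∉ vs × Safe (u ∷ vs) (e ∷ es)
  safe-answer {vs} {v = v} safe v∉ e with answer safe e
  ... | u , safe′ with em {u ∈ vs}
  ...   | no  u∉ = u , u∉ , safe′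
  ...   | yes u∈ = v , v∉ , Safe-mono (λ { (here refl) → there u∈ ; (there w∈) → there w∈ }) safe′

  -- A triangle with a marked edge is past `untouched`, and every later stage excludes the apex as
  -- an unmarked end; in `allBut` because `y` is not the apex.
  safe⇒≢apex : ∀ {vs es v e} → Safe vs es → v ∉ vs → e ∈ es → Incident v e → apex e ≢ v
  safe⇒≢apex {v = v} {e} safe v∉ e∈ ve c≡v with safe e
  ... | untouched none   = none e∈ ~-refl
  ... | apexOnly c∈ _    = v∉ (subst (_∈ _) c≡v c∈)
  ... | complete all     = v∉ (all ~-refl ve)
  ... | allBut y y≢c all _ = v∉ (all ~-refl ve λ v≡y → y≢c (trans (sym v≡y) (sym c≡v)))

  safe⇒unique : ∀ {vs es v e f} → Safe vs es → v ∉ vs → e ∈ es → f ∈ es →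
                Incident v e → Incident v f → e ~ f → e ≡ f
  safe⇒unique {v = v} {e} {f} safe v∉ e∈ f∈ ve vf e~f with safe f
  ... | untouched none    = contradiction ~-refl (none f∈)
  ... | apexOnly _ uniq   = uniq e∈ f∈ e~f ~-refl
  ... | complete all      = contradiction (all ~-refl vf) v∉
  ... | allBut y _ all uniq with em {v ≡ y}
  ...   | yes refl = uniq e∈ f∈ e~f ~-refl ve vf
  ...   | no  v≢y  = contradiction (all ~-refl vf v≢y) v∉

  degree : V → List E → ℕ
  degree v es = length (filter (λ e → em {Incident v e}) es)

  -- Of three distinct marked edges at `v`, none has its apex at `v`, so by `two-bases` two of them
  -- share a triangle and must coincide.
  safe⇒degree≤2 : ∀ {vs es v} → Safe vs es → Unique es → v ∉ vs → degree v es ℕ.≤ 2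
  safe⇒degree≤2 {vs} {es} {v} safe es! v∉ =
    bound (filter⁺ _ es!) (∈-filter⁻ (λ e → em {Incident v e}))
    where
    bound : ∀ {fs} → Unique fs → (∀ {f} → f ∈ fs → f ∈ es × Incident v f) → length fs ℕ.≤ 2
    bound {[]}              _ _ = z≤n
    bound {_ ∷ []}          _ _ = s≤s z≤n
    bound {_ ∷ _ ∷ []}      _ _ = s≤s (s≤s z≤n)
    bound {e ∷ f ∷ g ∷ _} ((e≢f ∷ e≢g ∷ _) ∷ (f≢g ∷ _) ∷ _) sound
      with sound (here refl) | sound (there (here refl)) | sound (there (there (here refl)))
    ... | e∈ , ve | f∈ , vf | g∈ , vg
      with two-bases ve vf vg (safe⇒≢apex safe v∉ e∈ ve) (safe⇒≢apex safe v∉ f∈ vf) (safe⇒≢apex safe v∉ g∈ vg)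
    ... | inj₁ e~f        = contradiction (safe⇒unique safe v∉ e∈ f∈ ve vf e~f) e≢f
    ... | inj₂ (inj₁ f~g) = contradiction (safe⇒unique safe v∉ f∈ g∈ vf vg f~g) f≢g
    ... | inj₂ (inj₂ e~g) = contradiction (safe⇒unique safe v∉ e∈ g∈ ve vg e~g) e≢g

  degree-∷ : ∀ v e es → degree v (e ∷ es) ℕ.≤ suc (degree v es)
  degree-∷ v e es with em {Incident v e}
  ... | yes _ = ℕₚ.≤-refl
  ... | no  _ = ℕₚ.n≤1+n _

  -- Alice's strategy and the bound on the score.

  SafeMove : History → V → Set
  SafeMove h u = u ∉ markedVertices h × Safe (u ∷ markedVertices h) (markedEdges h)

  -- A strategy must answer every history, including those that this one never reaches; without a
  -- safe move, `em` decides whether there is any legal move.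
  strategy : AliceStrategy
  strategy h with em {∃ (SafeMove h)}
  ... | yes (u , u∉ , _) = yes (u , u∉)
  ... | no _             = em

  -- A history ends with Bob's edge, whereas safety holds after Alice's move. So `move` promises
  -- that safety can be restored as long as Alice can move at all.
  record Reached (h : History) : Set where
    field
      move   : ∀ {v} → v ∉ markedVertices h → ∃ (SafeMove h)
      unique : Unique (markedEdges h)
      low    : ∀ v → vertexScore h v ℕ.≤ 3

  reached-[] : Reached []
  reached-[] = record
    { move   = λ {v} v∉ → v , v∉ , λ _ → untouched λ ()
    ; unique = []
    ; low    = low
    }
    where
    low : ∀ v → vertexScore [] v ℕ.≤ 3
    low v with em {v ∈ []}
    ... | yes _ = z≤n
    ... | no  _ = z≤n

  reached-∷ : ∀ {h u e} → Reached h → SafeMove h u → e ∉ markedEdges h → Reached ((u , e) ∷ h)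
  reached-∷ {h} {u} {e} R (u∉ , safe) e∉ = record
    { move   = λ v∉ → safe-answer safe v∉ e
    ; unique = ¬Any⇒All¬ _ e∉ ∷ Reached.unique R
    ; low    = low
    }
    where
    low : ∀ v → vertexScore ((u , e) ∷ h) v ℕ.≤ 3
    low v with em {v ∈ markedVertices ((u , e) ∷ h)}
    ... | yes _  = z≤n
    -- Safety held just before Bob marked `e`: two marked edges at `v` then, at most three now.
    ... | no  v∉ = ℕₚ.≤-trans (degree-∷ v e (markedEdges h))
                     (s≤s (safe⇒degree≤2 safe (Reached.unique R) v∉))

  reached-round : ∀ β {h} → Reached h → Reached (playRound strategy β h)
  reached-round β {h} R with em {∃ (SafeMove h)}
  reached-round β {h} R | yes (u , u∉ , safe) with β h u
  ... | no _         = R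
  ... | yes (e , e∉) = reached-∷ R (u∉ , safe) e∉
  reached-round β {h} R | no stuck with em {∃ λ v → v ∉ markedVertices h}
  ... | no _         = R
  ... | yes (v , v∉) = contradiction (Reached.move R v∉) stuck

  reached : ∀ β r → Reached (after strategy β r)
  reached β zero    = reached-[]
  reached β (suc r) = reached-round β (reached β r)

  finalScore≤3 : ∀ β → finalScore strategy β ≤⁺ [ 3 ]
  finalScore≤3 β = sup-least _ _ λ where
    _ (r , refl) → sup-least _ _ λ where
      _ (v , refl) → [ Reached.low (reached β r) v ]

  -- A winning strategy of Bob must also succeed against `strategy`, so it forces at most 3; the
  -- successor in `col-ve` gives 4.
  col-ve≤4 : col-ve em G ≤⁺ [ 4 ]
  col-ve≤4 = suc∞-mono (sup-least _ [ 3 ] λ where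
    _ (s , refl , β , wins) → ≤⁺-trans ℕₚ.≤-trans (wins strategy) (finalScore≤3 β))
    where
    suc∞-mono : ∀ {x n} → x ≤⁺ [ n ] → suc∞ x ≤⁺ [ suc n ]
    suc∞-mono [ x≤n ] = [ s≤s x≤n ]

-- The real number one half as a parameter of arcs.

fromℚ-mono-≤ : ∀ {p q} → p ℚ.≤ q → fromℚ p ≤ fromℚ q
fromℚ-mono-≤ {p} {q} p≤q (δ , 0<δ , N , q+δ≤p) = ℚₚ.<-irrefl refl (begin-strict
  q          ≡⟨ ℚₚ.+-identityʳ q ⟨
  q ℚ.+ 0ℚ   <⟨ ℚₚ.+-monoʳ-< q 0<δ ⟩
  q ℚ.+ δ    ≤⟨ q+δ≤p N ℕₚ.≤-refl ⟩
  p          ≤⟨ p≤q ⟩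
  q          ∎)
  where open ℚₚ.≤-Reasoning

½ℝ : ℝ
½ℝ = fromℚ ½

½∈UnitInterval : UnitInterval ½ℝ
½∈UnitInterval = fromℚ-mono-≤ (from-yes (0ℚ ℚₚ.≤? ½)) , fromℚ-mono-≤ (from-yes (½ ℚₚ.≤? 1ℚ))

0<½ : 0ℝ < ½ℝ
0<½ = ½ , from-yes (0ℚ ℚₚ.<? ½) , 0 , λ _ _ → ℚₚ.≤-refl

½<1 : ½ℝ < 1ℝ
½<1 = ½ , from-yes (0ℚ ℚₚ.<? ½) , 0 , λ _ _ → ℚₚ.≤-refl

≈-refl : ∀ x → x ≈ x
≈-refl x ε 0<ε = 0ℚ , 0<ε , 0 , λ n _ →
  ℚₚ.≤-reflexive (cong ℚ.∣_∣ (ℚₚ.+-inverseʳ (ℝ.seq x n)))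

≋-refl : ∀ p → p ≋ p
≋-refl (x , y) = ≈-refl x , ≈-refl y

-- The triangle system formed by the gray faces.

module _ (L : PlaneGraph) where
  open PlaneGraph L

  module _ (T : Triangle L) where
    open Triangle T

    side-corner : ∀ {e v} → IsSide e → Incident v e → IsCorner v
    side-corner (inj₁ refl) ve with joins⇒ends graph ab-joins ve
    ... | inj₁ v≡a = inj₁ v≡a
    ... | inj₂ v≡b = inj₂ (inj₁ v≡b)
    side-corner (inj₂ (inj₁ refl)) ve = inj₂ (joins⇒ends graph bc-joins ve)
    side-corner (inj₂ (inj₂ refl)) ve with joins⇒ends graph ca-joins ve
    ... | inj₁ v≡c = inj₂ (inj₂ v≡c)
    ... | inj₂ v≡a = inj₁ v≡a

    corner-side : ∀ {v} → IsCorner v → ∃ λ e → IsSide e × Incident v e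
    corner-side (inj₁ refl)        = ab , inj₁ refl , joins⇒incidentˡ graph ab-joins
    corner-side (inj₂ (inj₁ refl)) = bc , inj₂ (inj₁ refl) , joins⇒incidentˡ graph bc-joins
    corner-side (inj₂ (inj₂ refl)) = ca , inj₂ (inj₂ refl) , joins⇒incidentˡ graph ca-joins

    other-corners : ∀ {v} → IsCorner v → ∃ λ x → ∃ λ y → x ≢ y × x ≢ v × y ≢ v ×
                    (∀ {w} → IsCorner w → w ≡ v ⊎ w ≡ x ⊎ w ≡ y)
    other-corners (inj₁ refl) =
      b , c , joins⇒≢ graph bc-joins , ≢-sym (joins⇒≢ graph ab-joins) , joins⇒≢ graph ca-joins , λ w → w
    other-corners (inj₂ (inj₁ refl)) =
      a , c , ≢-sym (joins⇒≢ graph ca-joins) , joins⇒≢ graph ab-joins , ≢-sym (joins⇒≢ graph bc-joins) , λ where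
        (inj₁ w≡a)        → inj₂ (inj₁ w≡a)
        (inj₂ (inj₁ w≡b)) → inj₁ w≡b
        (inj₂ (inj₂ w≡c)) → inj₂ (inj₂ w≡c)
    other-corners (inj₂ (inj₂ refl)) =
      a , b , joins⇒≢ graph ab-joins , ≢-sym (joins⇒≢ graph ca-joins) , joins⇒≢ graph bc-joins , λ where
        (inj₁ w≡a)        → inj₂ (inj₁ w≡a)
        (inj₂ (inj₁ w≡b)) → inj₂ (inj₂ w≡b)
        (inj₂ (inj₂ w≡c)) → inj₁ w≡c

  SameFace-sym : Symmetric (SameFace L)
  SameFace-sym = EqClosure.symmetric (JoinedOff L)

  SameFace-trans : Transitive (SameFace L)
  SameFace-trans = EqClosure.transitive (JoinedOff L)

  -- A face is represented by any of its points, so its frontier and bounding triangle must be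
  -- carried between representatives.
  InFace-resp : ∀ {f g q} → SameFace L f g → InFace L q f → InFace L q g
  InFace-resp f~g (off , q~f) = off , EqClosure.transitive (JoinedOff L) q~f f~g

  Frontier-resp : ∀ {f g} p → SameFace L f g → Frontier L f p → Frontier L g p
  Frontier-resp {f} {g} p f~g front ε 0<ε with front ε 0<ε
  ... | (q , near , q∈f) , (q′ , near′ , q′∉f) =
    (q , near , InFace-resp {f} {g} f~g q∈f) ,
    (q′ , near′ , λ q′∈g → q′∉f (InFace-resp {g} {f} (SameFace-sym {f} {g} f~g) q′∈g))

  BoundedBy-resp : ∀ {f g T} → SameFace L f g → BoundedBy L f T → BoundedBy L g T
  BoundedBy-resp {f} {g} f~g bounds p = mk⇔
    (λ front → to (bounds p) (Frontier-resp {g} {f} p (SameFace-sym {f} {g} f~g) front))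
    (λ side → Frontier-resp {f} {g} p f~g (from (bounds p) side))
    where open Equivalence

  -- The midpoint of an edge lies on no other edge, so it determines the edge.
  sides-unique : ∀ {f T T′ e} → BoundedBy L f T → BoundedBy L f T′ →
                 Triangle.IsSide T e → Triangle.IsSide T′ e
  sides-unique {T′ = T′} {e} bounds bounds′ side
    with Equivalence.to (bounds′ mid) (Equivalence.from (bounds mid) (e , side , ½ℝ , ½∈UnitInterval , ≋-refl mid))
    where
    mid : Point
    mid = arcAt e ½ℝ
  ... | e′ , side′ , u , u∈ , mid≋ =
    subst (Triangle.IsSide T′) (sym (interior-edge 0<½ ½<1 u∈ mid≋)) side′

  -- Each corner is an end of a side, and the face determines the sides. So `CornerOf` does not
  -- depend on the triangle chosen in it.
  corners-unique : ∀ {f T T′ v} → BoundedBy L f T → BoundedBy L f T′ →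
                   Triangle.IsCorner T v → Triangle.IsCorner T′ v
  corners-unique {f} {T} {T′} bounds bounds′ corner with corner-side T corner
  ... | e , side , ve = side-corner T′ (sides-unique {f} {T} {T′} bounds bounds′ side) ve

  CornerOf-resp : ∀ {f g v} → SameFace L f g → CornerOf L v f → CornerOf L v g
  CornerOf-resp {f} {g} f~g (T , bounds , corner) = T , BoundedBy-resp {f} {g} {T} f~g bounds , corner

  module _ (κ : TwoColouring L)
           (edge-triangle : EachEdgeInExactlyOneGrayTriangle L κ)
           (M : AngleMarking L)
           (marked-angle : ExactlyOneMarkedAnglePerGrayTriangle L κ M)
           (two-unmarked : AtMostTwoUnmarkedAnglesPerVertex L κ M)
           where
    open AngleMarking M

    face : E → Face L
    face e = proj₁ (edge-triangle e)

    face-gray : ∀ e → Gray L κ (face e)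
    face-gray e = proj₁ (proj₂ (edge-triangle e))

    face-side : ∀ e → SideOf L e (face e)
    face-side e = proj₁ (proj₂ (proj₂ (edge-triangle e)))

    face-corner : ∀ {v} e → Incident v e → CornerOf L v (face e)
    face-corner e ve = Product.map₂ (λ {T} → Product.map₂ λ side → side-corner T side ve) (face-side e)

    markedCorner : E → V
    markedCorner e = proj₁ (marked-angle (face e) (face-gray e))

    markedCorner-corner : ∀ e → CornerOf L (markedCorner e) (face e)
    markedCorner-corner e = proj₁ (proj₂ (marked-angle (face e) (face-gray e)))

    markedCorner-marked : ∀ e → Marked (face e) (markedCorner e)
    markedCorner-marked e = proj₁ (proj₂ (proj₂ (marked-angle (face e) (face-gray e))))

    markedCorner-unique : ∀ e {w} → CornerOf L w (face e) → Marked (face e) w → markedCorner e ≡ w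
    markedCorner-unique e = proj₂ (proj₂ (proj₂ (marked-angle (face e) (face-gray e)))) _

    unmarked : ∀ {v} e → Incident v e → markedCorner e ≢ v → UnmarkedAngle L κ M (face e) v
    unmarked e ve c≢v = face-gray e , face-corner e ve , c≢v ∘ markedCorner-unique e (face-corner e ve)

    grayTriangles : TriangleSystem graph
    grayTriangles = record
      -- Edges of one triangle may receive different representatives of its face, hence `SameFace`
      -- rather than equality.
      { _~_       = λ e f → SameFace L (face e) (face f)
      ; ~-refl    = EqClosure.reflexive (JoinedOff L)
      ; ~-sym     = λ {e} {f} → SameFace-sym {face e} {face f}
      ; ~-trans   = λ {e} {f} {g} → SameFace-trans {face e} {face f} {face g}
      ; apex      = markedCorner
      -- The marked angle of one representative is a marked angle of the other, where it is unique.
      ; apex-cong = λ {e} {f} e~f → sym (markedCorner-unique f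
          (CornerOf-resp {face e} {face f} e~f (markedCorner-corner e))
          (respects e~f (markedCorner-marked e)))
      ; corners   = corners
      ; two-bases = λ {v} {e} {f} {g} ve vf vg c≢ d≢ e≢ →
          two-unmarked v (face e) (face f) (face g) (unmarked e ve c≢) (unmarked f vf d≢) (unmarked g vg e≢)
      }
      where
      corners : ∀ e → ∃ λ a → ∃ λ b → a ≢ b × a ≢ markedCorner e × b ≢ markedCorner e ×
                (∀ {f v} → SameFace L (face f) (face e) → Incident v f →
                 v ≡ markedCorner e ⊎ v ≡ a ⊎ v ≡ b)
      corners e with markedCorner-corner e
      ... | T , bounds , corner with other-corners T corner
      ...   | a , b , a≢b , a≢c , b≢c , cover = a , b , a≢b , a≢c , b≢c , λ {f} f~e vf →
        -- The edge `f` brings its own triangle `T′`, which has the same corners as `T`.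
        let T′ , bounds′ , corner′ = CornerOf-resp {face f} {face e} f~e (face-corner f vf)
        in cover (corners-unique {face e} {T′} {T} bounds′ bounds corner′)

theorem3p1 : (em : ExcludedMiddle 0ℓ)
    (L : PlaneGraph)
    (κ : TwoColouring L) →
    GrayFacesAreTriangles L κ →
    EachEdgeInExactlyOneGrayTriangle L κ →
    (M : AngleMarking L) →
    ExactlyOneMarkedAnglePerGrayTriangle L κ M →
    AtMostTwoUnmarkedAnglesPerVertex L κ M →
    col-ve em (PlaneGraph.graph L) ≤⁺ [ 4 ]
theorem3p1 em L κ _ edge-triangle M marked-angle two-unmarked =
  Alice.col-ve≤4 em (PlaneGraph.graph L)
    (grayTriangles L κ edge-triangle M marked-angle two-unmarked)
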